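{- Let $G,H$ be simple undirected graphs with vertex set $V=\{1,\dots,n\}$ and let $k\ge1$. Then $\mathcal Q^{k+1}_{G,H}\subseteq\mathcal T^k_{G,H}\subseteq\mathcal Q^k_{G,H}$ and $\mathcal Q^{k+1}_{G}\subseteq\mathcal T^k_{G}\subseteq\mathcal Q^k_{G}$.
   Context: $E_G$ is the edge set of $G$, $A_G$ its adjacency matrix, $\delta_G(a)$ the set of neighbours of $a$, and $e$ the all-ones vector. $$\mathcal T_{G,H}=\{X\in[0,1]^{n\times n}: A_GX=XA_H,\ Xe=X^Te=e\},$$ where $A_GX=XA_H$ reads $\sum_{w\in\delta_H(v)}X_{uw}-\sum_{w\in\delta_G(u)}X_{wv}=0$ for all $u,v\in V$. $\mathcal Q_{G,H}$ is the set of $X\in[0,1]^{n\times n}$ with $Xe=X^Te=e$, $X_{u_1v_1}X_{u_2v_2}=0$ for all $\{u_1,u_2\}\in E_G,\{v_1,v_2\}\notin E_H$, and $X_{u_1v_1}X_{u_2v_2}=0$ for all $\{u_1,u_2\}\notin E_G$, $\{v_1,v_2\}\in E_H$ (here $u_1=u_2$ counts as $\{u_1,u_2\}\notin E_G$, and $v_1=v_2$ as $\{v_1,v_2\}\notin E_H$). $\mathcal T_G=\mathcal T_{G,G}$ and $\mathcal Q_G=\mathcal Q_{G,G}$. **Sherali-Adams relaxations.** For $P=\{x\in[0,1]^N: f_j(x)=0\ (1\le j\le s),\ g_j(x)\ge 0\ (1\le j\le t)\}$ with polynomials $f_j,g_j$, the $k$th Sherali-Adams relaxation $P^k$ is obtained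 as follows. Form the constraints $\prod_{i\in I}x_i\, f_j(x)=0$ for all $I\subseteq\{1,\dots,N\}$, $|I|\le k-1$ and all $j$; $\prod_{i\in I}x_i\prod_{i\in J\setminus I}(1-x_i)\,g_j(x)\ge0$ for all $I\subseteq J$, $|J|\le k-1$ and all $j$; and $\prod_{i\in I}x_i\prod_{i\in J\setminus I}(1-x_i)\ge 0$ for all $I\subseteq J$, $|J|\le k$. Expand, replace every $x_i^2$ by $x_i$ repeatedly until all monomials are square-free, and replace each monomial $\prod_{i\in I}x_i$ with $|I|\ge 1$ by a new variable $y_I$ (and the empty monomial by $1$). This gives a polyhedron $\hat P^k$ in $y$-space, and $P^k=\{x: x_i=y_{\{i\}}\ \forall i,\ y\in\hat P^k\}$. The $f_j$ are the row-sum and column-sum equations together with the entries of $A_GX-XA_H$ (for $\mathcal T_{G,H}$) or the quadratic equations (for $\mathcal Q_{G,H}$); there are no $g_j$. $\mathcal T^k_{G,H},\mathcal T^k_G,\mathcal Q^k_{G,H},\mathcal Q^k_G$ denote the $k$th relaxations. -}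

module Defs where

open import Algebra.Apartness.Bundles using (HeytingField)
open import Data.Bool.Base using (if_then_else_)
open import Data.Empty using () renaming (⊥ to Void)
open import Data.Fin.Base using (Fin; combine; remQuot)
open import Data.Fin.Subset using (Subset; Side; inside; outside; _⊆_; _─_; ⁅_⁆; ∣_∣)
open import Data.Fin.Subset.Properties using (_∈?_; nonempty?)
open import Data.List.Base
  using (List; []; [_]; _++_; map; foldr; filter; allFin; cartesianProductWith)
open import Data.Nat.Base using (ℕ; zero; suc)
import Data.Nat.Base as ℕ
open import Data.Product.Base using (_×_; _,_; Σ-syntax; uncurry)
open import Data.Sum.Base using (_⊎_)
open import Data.Vec.Base using (Vec; replicate; zipWith; _[_]≔_)
import Data.Vec.Base as Vec
open import Function.Bundles using (_⇔_)
open import Level using (Level; _⊔_; 0ℓ) renaming (suc to lsuc)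
open import Relation.Binary.Core using (Rel)
open import Relation.Binary.Definitions using (Decidable; Symmetric)
open import Relation.Binary.Structures using (IsStrictPartialOrder)
open import Relation.Nullary.Decidable using (does)
open import Relation.Nullary.Negation using (¬_)
open import Relation.Unary using (Pred)

-- The scalars.  The library has no real numbers, so an arbitrary ordered field
-- takes the place of ℝ.  Everything is phrased so that the constructive reals
-- are an instance too: the order need not be decidable, and the apartness of
-- the Heyting field is required to be the one induced by _<_.  Classically
-- these are exactly the (totally) ordered fields.

record OrderedField c ℓ₁ ℓ₂ : Set (lsuc (c ⊔ ℓ₁ ⊔ ℓ₂)) where
  infix 4 _<_ _≤_
  field
    heytingField : HeytingField c ℓ₁ ℓ₂

  open HeytingField heytingField public

  field
    _<_                    : Rel Carrier ℓ₂
    <-isStrictPartialOrder : IsStrictPartialOrder _≈_ _<_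
    #⇔<⊎>                  : ∀ {x y} → (x # y) ⇔ (x < y ⊎ y < x)
    +-monoˡ-<              : ∀ z {x y} → x < y → x + z < y + z
    *-pos                  : ∀ {x y} → 0# < x → 0# < y → 0# < x * y

  _≤_ : Rel Carrier ℓ₂
  x ≤ y = ¬ (y < x)

record SimpleGraph (n : ℕ) : Set₁ where
  field
    Adj    : Rel (Fin n) 0ℓ
    adj?   : Decidable Adj
    sym    : Symmetric Adj
    irrefl : ∀ {u} → ¬ Adj u u

  neighbours : Fin n → List (Fin n)
  neighbours u = filter (adj? u) (allFin n)

module _ {c ℓ₁ ℓ₂} (𝔽 : OrderedField c ℓ₁ ℓ₂) where
  open OrderedField 𝔽 using (Carrier; _≈_; _≤_; _+_; _*_; -_; 0#; 1#)

  -- Exponent vectors.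
  Monomial : ℕ → Set
  Monomial N = Vec ℕ N

  -- Formal sums of coefficient–monomial pairs; like terms are not collected,
  -- which does not affect linearisation.
  Poly : ℕ → Set c
  Poly N = List (Carrier × Monomial N)

  module _ {N : ℕ} where
    infixl 7 _⊗_
    infixl 6 _⊕_ _⊖_

    𝟙 : Poly N
    𝟙 = [ 1# , replicate N 0 ]

    var : Fin N → Poly N
    var i = [ 1# , replicate N 0 [ i ]≔ 1 ]

    _⊕_ _⊖_ _⊗_ : Poly N → Poly N → Poly N
    p ⊕ q = p ++ q
    p ⊖ q = p ⊕ map (λ (a , m) → - a , m) q
    _⊗_ = cartesianProductWith (λ (a , m) (b , m′) → a * b , zipWith ℕ._+_ m m′)

    Σ[_] : ∀ {a} {A : Set a} → List A → (A → Poly N) → Poly N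
    Σ[ xs ] p = foldr (λ x s → p x ⊕ s) [] xs

    Π[_] : Subset N → (Fin N → Poly N) → Poly N
    Π[ S ] p = foldr (λ i s → p i ⊗ s) 𝟙 (filter (_∈? S) (allFin N))

    -- Reducing x_i² to x_i until a monomial is square-free leaves the product
    -- of the variables that occur in it.
    occurs : ℕ → Side
    occurs zero    = outside
    occurs (suc _) = inside

    support : Monomial N → Subset N
    support = Vec.map occurs

    -- y assigns a value to y_I for every set I; the value of y at the empty
    -- set is never used, as the empty monomial is replaced by 1.
    linMonomial : (Subset N → Carrier) → Subset N → Carrier
    linMonomial y I = if does (nonempty? I) then y I else 1#

    linearise : (Subset N → Carrier) → Poly N → Carrier
    linearise y = foldr (λ (a , m) s → a * linMonomial y (support m) + s) 0#

  -- The polynomial constraints f j = 0 and g j ≥ 0 on x ∈ [0,1]^N.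
  record System (N : ℕ) : Set (c ⊔ lsuc 0ℓ) where
    field
      EqIx   : Set
      f      : EqIx → Poly N
      IneqIx : Set
      g      : IneqIx → Poly N

  module SheraliAdams {N : ℕ} (P : System N) where
    open System P

    Πx Π1-x : Subset N → Poly N
    Πx   S = Π[ S ] var
    Π1-x S = Π[ S ] (λ i → 𝟙 ⊖ var i)

    -- The polyhedron in y-space.  A set I has size at most k − 1 iff ∣ I ∣ < k,
    -- as k ≥ 1.
    record Lifted (k : ℕ) (y : Subset N → Carrier) : Set (ℓ₁ ⊔ ℓ₂) where
      field
        eqs   : ∀ j I → ∣ I ∣ ℕ.< k →
                linearise y (Πx I ⊗ f j) ≈ 0#
        ineqs : ∀ j I J → I ⊆ J → ∣ J ∣ ℕ.< k →
                0# ≤ linearise y (Πx I ⊗ Π1-x (J ─ I) ⊗ g j)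
        box   : ∀ I J → I ⊆ J → ∣ J ∣ ℕ.≤ k →
                0# ≤ linearise y (Πx I ⊗ Π1-x (J ─ I))

    Relaxation : ℕ → Pred (Fin N → Carrier) (c ⊔ ℓ₁ ⊔ ℓ₂)
    Relaxation k x =
      Σ[ y ∈ (Subset N → Carrier) ] (∀ i → x i ≈ y ⁅ i ⁆) × Lifted k y

  module _ {n : ℕ} (G H : SimpleGraph n) where
    private
      module G = SimpleGraph G
      module H = SimpleGraph H

    -- The entries of X are numbered by Fin (n * n) through combine.
    X : Fin n → Fin n → Poly (n ℕ.* n)
    X u v = var (combine u v)

    data 𝒯-Eq : Set where
      row col : Fin n → 𝒯-Eq
      commute : Fin n → Fin n → 𝒯-Eq

    𝒯-f : 𝒯-Eq → Poly (n ℕ.* n)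
    𝒯-f (row u)       = Σ[ allFin n ] (λ v → X u v) ⊖ 𝟙
    𝒯-f (col v)       = Σ[ allFin n ] (λ u → X u v) ⊖ 𝟙
    𝒯-f (commute u v) = Σ[ H.neighbours v ] (λ w → X u w)
                      ⊖ Σ[ G.neighbours u ] (λ w → X w v)

    data 𝒬-Eq : Set where
      row col      : Fin n → 𝒬-Eq
      edge-nonedge : ∀ u₁ u₂ v₁ v₂ → G.Adj u₁ u₂ → ¬ H.Adj v₁ v₂ → 𝒬-Eq
      nonedge-edge : ∀ u₁ u₂ v₁ v₂ → ¬ G.Adj u₁ u₂ → H.Adj v₁ v₂ → 𝒬-Eq

    𝒬-f : 𝒬-Eq → Poly (n ℕ.* n)
    𝒬-f (row u)                          = Σ[ allFin n ] (λ v → X u v) ⊖ 𝟙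
    𝒬-f (col v)                          = Σ[ allFin n ] (λ u → X u v) ⊖ 𝟙
    𝒬-f (edge-nonedge u₁ u₂ v₁ v₂ _ _)   = X u₁ v₁ ⊗ X u₂ v₂
    𝒬-f (nonedge-edge u₁ u₂ v₁ v₂ _ _)   = X u₁ v₁ ⊗ X u₂ v₂

    𝒯-system 𝒬-system : System (n ℕ.* n)
    𝒯-system = record { EqIx = 𝒯-Eq ; f = 𝒯-f ; IneqIx = Void ; g = λ () }
    𝒬-system = record { EqIx = 𝒬-Eq ; f = 𝒬-f ; IneqIx = Void ; g = λ () }

    flatten : (Fin n → Fin n → Carrier) → Fin (n ℕ.* n) → Carrier
    flatten M i = uncurry M (remQuot n i)

    𝒯 𝒬 : ℕ → Pred (Fin n → Fin n → Carrier) (c ⊔ ℓ₁ ⊔ ℓ₂)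
    𝒯 k M = SheraliAdams.Relaxation 𝒯-system k (flatten M)
    𝒬 k M = SheraliAdams.Relaxation 𝒬-system k (flatten M)

  𝒯ᵃ 𝒬ᵃ : ∀ {n} → SimpleGraph n → ℕ → Pred (Fin n → Fin n → Carrier) (c ⊔ ℓ₁ ⊔ ℓ₂)
  𝒯ᵃ G = 𝒯 G G
  𝒬ᵃ G = 𝒬 G G

{-# OPTIONS --safe #-}
-- Write z(I) for the linearisation of ∏_{i∈I} x_i, and uv for the variable X_uv.
-- 𝒬ᵏ⁺¹ ⊆ 𝒯ᵏ: for w ∈ δ_H(v), expanding z(I ∪ {uw}) by the equation of column v
-- leaves only the terms z(I ∪ {uw , w′v}) with w′ ∈ δ_G(u), by the quadratic
-- equations; expanding the other side of the commutation equation by the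
-- equation of row u gives the same double sum.
-- 𝒯ᵏ ⊆ 𝒬ᵏ: the box constraints make z nonnegative, so by the row equations two
-- distinct cells of one row (likewise of one column) never occur together, and
-- the commutation equation conditioned on u₁v₁ then forces z(I) = 0 for every
-- I ∋ u₁v₁ , u₂v₂ of size at most k that violates adjacency.
module Submission where

open import Defs
open import Algebra.Apartness.Bundles using (HeytingCommutativeRing)
open import Algebra.Bundles using (CommutativeRing)
import Algebra.Properties.CommutativeSemigroup as CommutativeSemigroupProperties
import Algebra.Properties.Ring as RingProperties
open import Data.Fin.Base using (Fin; zero; suc; combine)
import Data.Fin.Properties as Fin
open import Data.Fin.Subset
  using (Subset; Side; outside; inside; ⊥; ⁅_⁆; _∪_; _─_; _∈_; ∣_∣)
  renaming (_-_ to _∖_; _⊆_ to _⊑_)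
import Data.Fin.Subset.Properties as Subset
open import Data.List.Base using (List; []; _∷_; [_]; _++_; map; foldr; filter; allFin)
open import Data.List.Membership.Propositional using () renaming (_∈_ to _∈ᴸ_)
import Data.List.Membership.Propositional.Properties as Membership
open import Data.List.Properties using (filter-none)
open import Data.List.Relation.Unary.All as All using (All; []; _∷_)
import Data.List.Relation.Unary.All.Properties as All
open import Data.List.Relation.Unary.Any using (here; there)
open import Data.Nat.Base using (ℕ; zero; suc; _≤_; s≤s)
import Data.Nat.Base as ℕ
import Data.Nat.Properties as ℕ
open import Data.Product.Base using (_×_; _,_; proj₁; proj₂; ∃₂; ∃-syntax)
open import Data.Sum.Base using (_⊎_; inj₁; inj₂; [_,_]′)
open import Data.Vec.Base as Vec using (Vec; []; _∷_; replicate; zipWith; _[_]≔_)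
open import Data.Vec.Properties using (map-replicate)
open import Function.Base using (_∘_; flip)
open import Function.Bundles using (Equivalence)
open import Relation.Binary.PropositionalEquality as ≡ using (_≡_; _≢_)
import Relation.Binary.Reasoning.Setoid as ≈-Reasoning
open import Relation.Binary.Structures using (IsStrictPartialOrder)
open import Relation.Nullary.Decidable using (yes; no)
open import Relation.Nullary.Negation using (¬_; contradiction)
open import Relation.Unary using (_⊆_; Decidable)

-- Finite subsets of the variable set.

module _ {N : ℕ} where

  ∪-absorbs-∈ : {I : Subset N} {i : Fin N} → i ∈ I → I ∪ ⁅ i ⁆ ≡ I
  ∪-absorbs-∈ {I} {i} i∈I = Subset.⊆-antisym
    (λ x∈ → [ (λ x∈I → x∈I)
            , (λ x∈⁅i⁆ → ≡.subst (_∈ I) (≡.sym (Subset.x∈⁅y⁆⇒x≡y i x∈⁅i⁆)) i∈I)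
            ]′ (Subset.x∈p∪q⁻ I ⁅ i ⁆ x∈))
    (Subset.p⊆p∪q ⁅ i ⁆)

  ∖-∪-cancel : {I : Subset N} {i : Fin N} → i ∈ I → (I ∖ i) ∪ ⁅ i ⁆ ≡ I
  ∖-∪-cancel {I} {i} i∈I = Subset.⊆-antisym
    (λ x∈ → [ Subset.p─q⊆p I ⁅ i ⁆
            , (λ x∈⁅i⁆ → ≡.subst (_∈ I) (≡.sym (Subset.x∈⁅y⁆⇒x≡y i x∈⁅i⁆)) i∈I)
            ]′ (Subset.x∈p∪q⁻ (I ∖ i) ⁅ i ⁆ x∈))
    λ {x} x∈I → Subset.x∈p∪q⁺ (split x x∈I)
    where
    split : ∀ x → x ∈ I → x ∈ I ∖ i ⊎ x ∈ ⁅ i ⁆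
    split x x∈I with x Fin.≟ i
    ... | yes ≡.refl = inj₂ (Subset.x∈⁅x⁆ i)
    ... | no  x≢i    = inj₁ (Subset.x∈p∧x≢y⇒x∈p-y x∈I x≢i)

  ─-self : (I : Subset N) → I ─ I ≡ ⊥
  ─-self I = Subset.Empty-unique λ (x , x∈) → ∉ I x∈
    where
    ∉ : ∀ {M} (J : Subset M) {x} → ¬ x ∈ J ─ J
    ∉ (inside  ∷ J) (Vec.there p) = ∉ J p
    ∉ (outside ∷ J) (Vec.there p) = ∉ J p

  -- The fold is the support of the monomial to which the product of the variables in `I` expands.
  foldr-∪≡ : (I : Subset N) →
             foldr (λ i S → ⁅ i ⁆ ∪ S) ⊥ (filter (Subset._∈? I) (allFin N)) ≡ I
  foldr-∪≡ I = Subset.⊆-antisym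
    (λ x∈ → proj₂ (Membership.∈-filter⁻ (Subset._∈? I) {xs = allFin N} (∈-foldr⁻ _ x∈)))
    (λ x∈I → ∈-foldr⁺ (Membership.∈-filter⁺ (Subset._∈? I) (Membership.∈-allFin _) x∈I))
    where
    ∈-foldr⁻ : ∀ xs {x} → x ∈ foldr (λ i S → ⁅ i ⁆ ∪ S) ⊥ xs → x ∈ᴸ xs
    ∈-foldr⁻ []       x∈ = contradiction x∈ Subset.∉⊥
    ∈-foldr⁻ (i ∷ xs) x∈ with Subset.x∈p∪q⁻ ⁅ i ⁆ _ x∈
    ... | inj₁ x∈⁅i⁆ = here (Subset.x∈⁅y⁆⇒x≡y i x∈⁅i⁆)
    ... | inj₂ x∈xs  = there (∈-foldr⁻ xs x∈xs)

    ∈-foldr⁺ : ∀ {xs x} → x ∈ᴸ xs → x ∈ foldr (λ i S → ⁅ i ⁆ ∪ S) ⊥ xs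
    ∈-foldr⁺ (here ≡.refl) = Subset.x∈p∪q⁺ (inj₁ (Subset.x∈⁅x⁆ _))
    ∈-foldr⁺ (there x∈)    = Subset.x∈p∪q⁺ (inj₂ (∈-foldr⁺ x∈))

∣p∪⁅x⁆∣≤1+∣p∣ : ∀ {N} (I : Subset N) i → ∣ I ∪ ⁅ i ⁆ ∣ ≤ suc ∣ I ∣
∣p∪⁅x⁆∣≤1+∣p∣ (outside ∷ I) zero = s≤s (ℕ.≤-reflexive (≡.cong ∣_∣ (Subset.∪-identityʳ I)))
∣p∪⁅x⁆∣≤1+∣p∣ (inside ∷ I)  zero =
  ℕ.m≤n⇒m≤1+n (s≤s (ℕ.≤-reflexive (≡.cong ∣_∣ (Subset.∪-identityʳ I))))
∣p∪⁅x⁆∣≤1+∣p∣ (outside ∷ I) (suc i) = ∣p∪⁅x⁆∣≤1+∣p∣ I i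
∣p∪⁅x⁆∣≤1+∣p∣ (inside ∷ I)  (suc i) = s≤s (∣p∪⁅x⁆∣≤1+∣p∣ I i)

∈-neighbours⇒Adj : ∀ {n} (G : SimpleGraph n) {u w} →
                   w ∈ᴸ SimpleGraph.neighbours G u → SimpleGraph.Adj G u w
∈-neighbours⇒Adj {n} G {u} w∈ =
  proj₂ (Membership.∈-filter⁻ (SimpleGraph.adj? G u) {xs = allFin n} w∈)

-- Ordered fields: nonnegative sums without a decidable order.

module FieldLemmas {c ℓ₁ ℓ₂} (𝔽 : OrderedField c ℓ₁ ℓ₂) where

  open OrderedField 𝔽 renaming (_≤_ to _≤ᶠ_)

  ring : CommutativeRing c ℓ₁
  ring = HeytingCommutativeRing.commutativeRing heytingCommutativeRing

  open RingProperties (CommutativeRing.ring ring) public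
    using (-‿distribˡ-*; -0#≈0#; -‿+-comm) renaming (x∙y⁻¹≈ε⇒x≈y to x-y≈0⇒x≈y)
  open CommutativeSemigroupProperties (CommutativeRing.+-commutativeSemigroup ring) public
    using (interchange) renaming (x∙yz≈y∙xz to x+[y+z]≈y+[x+z])
  open IsStrictPartialOrder <-isStrictPartialOrder public
    using (<-respˡ-≈; <-respʳ-≈) renaming (trans to <-trans)
  open ≈-Reasoning setoid

  x≈y⇒x-y≈0 : ∀ {x y} → x ≈ y → x - y ≈ 0#
  x≈y⇒x-y≈0 {x} {y} x≈y = trans (+-congʳ x≈y) (-‿inverseʳ y)

  ≤-respʳ-≈ : ∀ {x y z} → y ≈ z → x ≤ᶠ y → x ≤ᶠ z
  ≤-respʳ-≈ y≈z x≤y z<x = x≤y (<-respˡ-≈ (sym y≈z) z<x)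

  -- Signs cannot be decided, so cotransitivity splits `x + y # 0` at the point `x`. Each of the
  -- four resulting strict inequalities makes `x` or `y` negative.
  +-nonneg : ∀ {x y} → 0# ≤ᶠ x → 0# ≤ᶠ y → 0# ≤ᶠ x + y
  +-nonneg {x} {y} 0≤x 0≤y x+y<0
    with #-cotrans (Equivalence.from #⇔<⊎> (inj₁ x+y<0)) x
  ... | inj₂ x#0 with Equivalence.to #⇔<⊎> x#0
  ...   | inj₁ x<0 = 0≤x x<0
  ...   | inj₂ 0<x = 0≤y (<-trans (<-respˡ-≈ (+-identityˡ y) (+-monoˡ-< y 0<x)) x+y<0)
  +-nonneg {x} {y} 0≤x 0≤y x+y<0
      | inj₁ x+y#x with Equivalence.to #⇔<⊎> x+y#x
  ...   | inj₁ x+y<x = 0≤y (<-respʳ-≈ (-‿inverseʳ x) (<-respˡ-≈ x+y-x≈y (+-monoˡ-< (- x) x+y<x)))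
    where
    x+y-x≈y : x + y - x ≈ y
    x+y-x≈y = begin
      x + y - x   ≈⟨ +-congʳ (+-comm x y) ⟩
      y + x - x   ≈⟨ +-assoc y x (- x) ⟩
      y + (x - x) ≈⟨ +-congˡ (-‿inverseʳ x) ⟩
      y + 0#      ≈⟨ +-identityʳ y ⟩
      y           ∎
  ...   | inj₂ x<x+y = 0≤x (<-trans x<x+y x+y<0)

  -- By tightness it suffices to refute `x # 0#`; if `0# < x`, then `y < x + y ≈ 0#`.
  nonneg∧+≈0⇒ˡ≈0 : ∀ {x y} → 0# ≤ᶠ x → 0# ≤ᶠ y → x + y ≈ 0# → x ≈ 0#
  nonneg∧+≈0⇒ˡ≈0 {x} {y} 0≤x 0≤y x+y≈0 = proj₁ (tight x 0#) λ x#0 →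
    [ 0≤x
    , (λ 0<x → 0≤y (<-respʳ-≈ x+y≈0 (<-respˡ-≈ (+-identityˡ y) (+-monoˡ-< y 0<x)))) ]′
    (Equivalence.to #⇔<⊎> x#0)

  module _ {a} {A : Set a} where

    ∑ : List A → (A → Carrier) → Carrier
    ∑ xs f = foldr (λ x s → f x + s) 0# xs

    ∑-cong : ∀ xs {f g : A → Carrier} → (∀ {x} → x ∈ᴸ xs → f x ≈ g x) → ∑ xs f ≈ ∑ xs g
    ∑-cong []       f≈g = refl
    ∑-cong (x ∷ xs) f≈g = +-cong (f≈g (here ≡.refl)) (∑-cong xs (f≈g ∘ there))

    ∑-zero : ∀ xs → ∑ xs (λ _ → 0#) ≈ 0#
    ∑-zero []       = refl
    ∑-zero (x ∷ xs) = trans (+-identityˡ _) (∑-zero xs)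

    ∑-+ : ∀ xs (f g : A → Carrier) → ∑ xs (λ x → f x + g x) ≈ ∑ xs f + ∑ xs g
    ∑-+ []       f g = sym (+-identityˡ 0#)
    ∑-+ (x ∷ xs) f g = trans (+-congˡ (∑-+ xs f g)) (interchange (f x) (g x) _ _)

    -- Since `neighbours` filters `allFin`, this turns a full row sum into a sum over neighbours
    -- once the other terms vanish.
    ∑-filter : ∀ {p} {P : A → Set p} (P? : Decidable P) xs {f : A → Carrier} →
               (∀ x → ¬ P x → f x ≈ 0#) → ∑ (filter P? xs) f ≈ ∑ xs f
    ∑-filter P? []       f≈0 = refl
    ∑-filter P? (x ∷ xs) f≈0 with P? x
    ... | yes px = +-congˡ (∑-filter P? xs f≈0)
    ... | no ¬px = begin
      ∑ (filter P? xs) _ ≈⟨ ∑-filter P? xs f≈0 ⟩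
      ∑ xs _             ≈⟨ +-identityˡ _ ⟨
      0# + ∑ xs _        ≈⟨ +-congʳ (f≈0 x ¬px) ⟨
      _ + ∑ xs _         ∎

    module _ {f : A → Carrier} (0≤f : ∀ x → 0# ≤ᶠ f x) where

      ∑-nonneg : ∀ xs → 0# ≤ᶠ ∑ xs f
      ∑-nonneg []       = proj₂ (tight 0# 0#) refl ∘ Equivalence.from #⇔<⊎> ∘ inj₁
      ∑-nonneg (x ∷ xs) = +-nonneg (0≤f x) (∑-nonneg xs)

      ∑-extract : ∀ {xs x} → x ∈ᴸ xs → ∃[ r ] 0# ≤ᶠ r × ∑ xs f ≈ f x + r
      ∑-extract {_ ∷ xs} (here ≡.refl) = ∑ xs f , ∑-nonneg xs , refl
      ∑-extract {x ∷ xs} (there y∈xs) with r , 0≤r , eq ← ∑-extract y∈xs =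
        f x + r , +-nonneg (0≤f x) 0≤r , trans (+-congˡ eq) (x+[y+z]≈y+[x+z] (f x) _ r)

      ∑-extract₂ : ∀ {xs x y} → x ∈ᴸ xs → y ∈ᴸ xs → x ≢ y →
                   ∃[ r ] 0# ≤ᶠ r × ∑ xs f ≈ f x + (f y + r)
      ∑-extract₂ (here ≡.refl) (here ≡.refl) x≢y = contradiction ≡.refl x≢y
      ∑-extract₂ (here ≡.refl) (there y∈xs)  x≢y with r , 0≤r , eq ← ∑-extract y∈xs =
        r , 0≤r , +-congˡ eq
      ∑-extract₂ {x = x} (there x∈xs) (here ≡.refl) x≢y with r , 0≤r , eq ← ∑-extract x∈xs =
        r , 0≤r , trans (+-congˡ eq) (x+[y+z]≈y+[x+z] _ (f x) r)
      ∑-extract₂ {w ∷ xs} {x} {y} (there x∈xs) (there y∈xs) x≢y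
        with r , 0≤r , eq ← ∑-extract₂ x∈xs y∈xs x≢y =
        f w + r , +-nonneg (0≤f w) 0≤r , (begin
          f w + ∑ xs f              ≈⟨ +-congˡ eq ⟩
          f w + (f x + (f y + r))   ≈⟨ x+[y+z]≈y+[x+z] (f w) (f x) _ ⟩
          f x + (f w + (f y + r))   ≈⟨ +-congˡ (x+[y+z]≈y+[x+z] (f w) (f y) r) ⟩
          f x + (f y + (f w + r))   ∎)

      ∑≈0⇒term≈0 : ∀ {xs x} → x ∈ᴸ xs → ∑ xs f ≈ 0# → f x ≈ 0#
      ∑≈0⇒term≈0 x∈xs ∑≈0 with r , 0≤r , eq ← ∑-extract x∈xs =
        nonneg∧+≈0⇒ˡ≈0 (0≤f _) 0≤r (trans (sym eq) ∑≈0)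

      -- Cancelling `f x` leaves `f y` plus a nonnegative remainder equal to zero. This makes two
      -- cells of one row exclude each other.
      ∑≈term⇒other≈0 : ∀ {xs x y} → x ∈ᴸ xs → y ∈ᴸ xs → x ≢ y → ∑ xs f ≈ f x → f y ≈ 0#
      ∑≈term⇒other≈0 {xs} {x} {y} x∈xs y∈xs x≢y ∑≈fx
        with r , 0≤r , eq ← ∑-extract₂ x∈xs y∈xs x≢y =
        nonneg∧+≈0⇒ˡ≈0 (0≤f y) 0≤r (begin
          f y + r                   ≈⟨ +-identityˡ _ ⟨
          0# + (f y + r)            ≈⟨ +-congʳ (-‿inverseˡ (f x)) ⟨
          - f x + f x + (f y + r)   ≈⟨ +-assoc _ _ _ ⟩
          - f x + (f x + (f y + r)) ≈⟨ +-congˡ (trans (sym eq) ∑≈fx) ⟩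
          - f x + f x               ≈⟨ -‿inverseˡ (f x) ⟩
          0#                        ∎)

  ∑-swap : ∀ {a b} {A : Set a} {B : Set b} xs ys (f : A → B → Carrier) →
           ∑ xs (λ x → ∑ ys (f x)) ≈ ∑ ys (λ y → ∑ xs (λ x → f x y))
  ∑-swap []       ys f = sym (∑-zero ys)
  ∑-swap (x ∷ xs) ys f = begin
    ∑ ys (f x) + ∑ xs (λ x → ∑ ys (f x))                 ≈⟨ +-congˡ (∑-swap xs ys f) ⟩
    ∑ ys (f x) + ∑ ys (λ y → ∑ xs (λ x → f x y))         ≈⟨ ∑-+ ys (f x) _ ⟨
    ∑ ys (λ y → f x y + ∑ xs (λ x → f x y))              ∎

  -- Linearised constraints as identities for a set function `z`.

  module _ {N n : ℕ} where

    -- A cell function numbers the pairs (u , v).  Flipping it exchanges the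
    -- roles of the two graphs, which halves the arguments below.
    Cell : Set
    Cell = Fin n → Fin n → Fin N

    -- The row equations times the variables of `I`, linearised: the constant term contributes
    -- `z I`. At `flip cell` these are the column equations.
    Rows : Cell → ℕ → (Subset N → Carrier) → Set ℓ₁
    Rows cell k z = ∀ u I → ∣ I ∣ ℕ.< k → ∑ (allFin n) (λ v → z (I ∪ ⁅ cell u v ⁆)) ≈ z I

    module _ (cell : Cell) (G H : SimpleGraph n) (k : ℕ) (z : Subset N → Carrier) where
      private
        module G = SimpleGraph G
        module H = SimpleGraph H

      Commutes : Set ℓ₁
      Commutes = ∀ u v I → ∣ I ∣ ℕ.< k →
        ∑ (H.neighbours v) (λ w → z (I ∪ ⁅ cell u w ⁆)) ≈
        ∑ (G.neighbours u) (λ w → z (I ∪ ⁅ cell w v ⁆))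

      -- One half of the quadratic equations. The other half is the same condition at `flip cell`
      -- with the two graphs exchanged.
      PreservesEdges : Set ℓ₁
      PreservesEdges = ∀ {u₁ u₂ v₁ v₂} → G.Adj u₁ u₂ → ¬ H.Adj v₁ v₂ → ∀ I → ∣ I ∣ ℕ.< k →
        z (I ∪ (⁅ cell u₁ v₁ ⁆ ∪ ⁅ cell u₂ v₂ ⁆)) ≈ 0#

    module _ (cell : Cell) (G H : SimpleGraph n) {k : ℕ} {z : Subset N → Carrier} where
      private
        module G = SimpleGraph G
        module H = SimpleGraph H

      -- Expand by row `u′`; since `u` and `u′` are adjacent, the quadratic equations remove every
      -- column that is not a neighbour of `v`. The level drops by one here: the row equation is
      -- multiplied by `J`, which may have size `k`.
      row-along-edge : Rows cell (suc k) z → PreservesEdges cell G H (suc k) z →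
        ∀ {u u′} → G.Adj u u′ → ∀ v I → ∣ I ∣ ℕ.< k →
        z (I ∪ ⁅ cell u v ⁆) ≈
        ∑ (H.neighbours v) (λ w → z ((I ∪ ⁅ cell u v ⁆) ∪ ⁅ cell u′ w ⁆))
      row-along-edge rows edges {u} {u′} uu′ v I ∣I∣<k = begin
        z J
          ≈⟨ rows u′ J (s≤s ∣J∣≤k) ⟨
        ∑ (allFin n) (λ w → z (J ∪ ⁅ cell u′ w ⁆))
          ≈⟨ ∑-filter (H.adj? v) (allFin n) nonedge≈0 ⟨
        ∑ (H.neighbours v) (λ w → z (J ∪ ⁅ cell u′ w ⁆)) ∎
        where
        J = I ∪ ⁅ cell u v ⁆

        ∣J∣≤k : ∣ J ∣ ℕ.≤ k
        ∣J∣≤k = ℕ.≤-trans (∣p∪⁅x⁆∣≤1+∣p∣ I (cell u v)) ∣I∣<k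

        nonedge≈0 : ∀ w → ¬ H.Adj v w → z (J ∪ ⁅ cell u′ w ⁆) ≈ 0#
        nonedge≈0 w ¬vw = trans
          (reflexive (≡.cong z (Subset.∪-assoc I ⁅ cell u v ⁆ ⁅ cell u′ w ⁆)))
          (edges uu′ ¬vw I (ℕ.m<n⇒m<1+n ∣I∣<k))

      -- Two cells of one row exclude each other, so at J ∋ cell u₁ v₁ the row
      -- side of the commutation equation for (u₁ , v₂) vanishes when v₁v₂ ∉ E_H;
      -- hence so does every term of the column side.
      edge-nonedge≈0 : (∀ {u u′ v v′} → cell u v ≡ cell u′ v′ → u ≡ u′) →
        (∀ I → ∣ I ∣ ℕ.≤ k → 0# ≤ᶠ z I) → Rows cell k z → Commutes cell G H k z →
        ∀ {u₁ u₂ v₁ v₂} → G.Adj u₁ u₂ → ¬ H.Adj v₁ v₂ →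
        ∀ {I} → cell u₁ v₁ ∈ I → cell u₂ v₂ ∈ I → ∣ I ∣ ℕ.≤ k → z I ≈ 0#
      edge-nonedge≈0 cell-injective 0≤z rows commutes {u₁} {u₂} {v₁} {v₂} u₁u₂ ¬v₁v₂ {I} ∈I₁ ∈I₂ ∣I∣≤k =
        begin
          z I                    ≡⟨ ≡.cong z (∖-∪-cancel ∈I₂) ⟨
          z (J ∪ ⁅ cell u₂ v₂ ⁆) ≈⟨ ∑≈0⇒term≈0 (λ w → 0≤z-extension (cell w v₂))
                                        (Membership.∈-filter⁺ (G.adj? u₁) (Membership.∈-allFin u₂) u₁u₂)
                                        (trans (sym (commutes u₁ v₂ J ∣J∣<k)) row-side≈0) ⟩
          0#                     ∎
        where
        -- The equations hold only for multipliers of size below `k`, so one cell is taken out; `I`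
        -- comes back as the term `w = u₂` of the column side.
        J = I ∖ cell u₂ v₂

        ∣J∣<k : ∣ J ∣ ℕ.< k
        ∣J∣<k = ℕ.<-≤-trans (Subset.x∈p⇒∣p-x∣<∣p∣ ∈I₂) ∣I∣≤k

        0≤z-extension : ∀ i → 0# ≤ᶠ z (J ∪ ⁅ i ⁆)
        0≤z-extension i = 0≤z _ (ℕ.≤-trans (∣p∪⁅x⁆∣≤1+∣p∣ J i) ∣J∣<k)

        -- The graph has no loops, so `u₁` and `u₂` differ and the first cell survives the removal.
        ∈J : cell u₁ v₁ ∈ J
        ∈J = Subset.x∈p∧x≢y⇒x∈p-y ∈I₁ λ eq →
          G.irrefl (≡.subst (G.Adj u₁) (≡.sym (cell-injective eq)) u₁u₂)

        excluded : ∀ {w} → v₁ ≢ w → z (J ∪ ⁅ cell u₁ w ⁆) ≈ 0#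
        excluded {w} v₁≢w = ∑≈term⇒other≈0 (λ w → 0≤z-extension (cell u₁ w))
          (Membership.∈-allFin v₁) (Membership.∈-allFin w) v₁≢w
          -- As `J` already contains `cell u₁ v₁`, the term at `v₁` is `z J`, which is also the
          -- whole row sum.
          (trans (rows u₁ J ∣J∣<k) (reflexive (≡.cong z (≡.sym (∪-absorbs-∈ ∈J)))))

        row-side≈0 : ∑ (H.neighbours v₂) (λ w → z (J ∪ ⁅ cell u₁ w ⁆)) ≈ 0#
        row-side≈0 = trans
          (∑-cong (H.neighbours v₂) λ {w} w∈ → excluded λ v₁≡w →
            ¬v₁v₂ (≡.subst (λ v → H.Adj v v₂) (≡.sym v₁≡w) (H.sym (∈-neighbours⇒Adj H w∈))))
          (∑-zero (H.neighbours v₂))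

    commutes-from-edges : (cell : Cell) (G H : SimpleGraph n) {k : ℕ} {z : Subset N → Carrier} →
      Rows cell (suc k) z → Rows (flip cell) (suc k) z →
      PreservesEdges cell G H (suc k) z → PreservesEdges (flip cell) H G (suc k) z →
      Commutes cell G H k z
    commutes-from-edges cell G H {k} {z} rows cols edges edgesᵀ u v I ∣I∣<k = begin
      ∑ (H.neighbours v) (λ w → z (I ∪ ⁅ cell u w ⁆))
        ≈⟨ ∑-cong (H.neighbours v) (λ w∈ →
             -- Column `v` acts as a row of the flipped cell function, and `w` is joined to `v` in
             -- `H`.
             row-along-edge (flip cell) H G cols edgesᵀ (H.sym (∈-neighbours⇒Adj H w∈)) u I ∣I∣<k) ⟩
      ∑ (H.neighbours v) (λ w → ∑ (G.neighbours u) (λ w′ → z ((I ∪ ⁅ cell u w ⁆) ∪ ⁅ cell w′ v ⁆)))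
        ≈⟨ ∑-swap (H.neighbours v) (G.neighbours u) _ ⟩
      ∑ (G.neighbours u) (λ w′ → ∑ (H.neighbours v) (λ w → z ((I ∪ ⁅ cell u w ⁆) ∪ ⁅ cell w′ v ⁆)))
        ≈⟨ ∑-cong (G.neighbours u) (λ _ → ∑-cong (H.neighbours v) (λ _ →
             -- The two double sums differ only in the order in which the cells are adjoined.
             reflexive (≡.cong z (∪-right-comm _ _)))) ⟩
      ∑ (G.neighbours u) (λ w′ → ∑ (H.neighbours v) (λ w → z ((I ∪ ⁅ cell w′ v ⁆) ∪ ⁅ cell u w ⁆)))
        ≈⟨ ∑-cong (G.neighbours u) (λ w∈ →
             row-along-edge cell G H rows edges (G.sym (∈-neighbours⇒Adj G w∈)) v I ∣I∣<k) ⟨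
      ∑ (G.neighbours u) (λ w′ → z (I ∪ ⁅ cell w′ v ⁆)) ∎
      where
      module G = SimpleGraph G
      module H = SimpleGraph H

      ∪-right-comm : ∀ J K → (I ∪ J) ∪ K ≡ (I ∪ K) ∪ J
      ∪-right-comm J K = ≡.trans (Subset.∪-assoc I J K)
        (≡.trans (≡.cong (I ∪_) (Subset.∪-comm J K)) (≡.sym (Subset.∪-assoc I K J)))

-- From formal polynomials to values of `z`.

module Linearisation {c ℓ₁ ℓ₂} (𝔽 : OrderedField c ℓ₁ ℓ₂) {N : ℕ} where

  open OrderedField 𝔽 renaming (_≤_ to _≤ᶠ_)
  open FieldLemmas 𝔽
  open ≈-Reasoning setoid

  infixl 7 _⊗ᵖ_
  infixl 6 _⊖ᵖ_

  _⊗ᵖ_ _⊖ᵖ_ : Poly 𝔽 N → Poly 𝔽 N → Poly 𝔽 N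
  _⊗ᵖ_ = _⊗_ 𝔽
  _⊖ᵖ_ = _⊖_ 𝔽

  private
    ⟦_⟧ : Monomial 𝔽 N → Subset N
    ⟦_⟧ = support 𝔽

    occ : ℕ → Side
    occ = occurs 𝔽 {N}

    Σvar : ∀ {a} {A : Set a} → List A → (A → Fin N) → Poly 𝔽 N
    Σvar xs i = Σ[_] 𝔽 xs (λ x → var 𝔽 (i x))

  support-1 : ⟦ replicate N 0 ⟧ ≡ ⊥
  support-1 = map-replicate occ 0 N

  support-var : ∀ i → ⟦ replicate N 0 [ i ]≔ 1 ⟧ ≡ ⁅ i ⁆
  support-var = go N
    where
    go : ∀ M i → Vec.map occ (replicate M 0 [ i ]≔ 1) ≡ ⁅ i ⁆
    go (suc M) zero    = ≡.cong (inside ∷_) (map-replicate occ 0 M)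
    go (suc M) (suc i) = ≡.cong (outside ∷_) (go M i)

  support-* : ∀ m m′ → ⟦ zipWith ℕ._+_ m m′ ⟧ ≡ ⟦ m ⟧ ∪ ⟦ m′ ⟧
  support-* = go
    where
    go : ∀ {M} (m m′ : Vec ℕ M) → Vec.map occ (zipWith ℕ._+_ m m′) ≡
         Vec.map occ m ∪ Vec.map occ m′
    go []          []       = ≡.refl
    go (zero ∷ m)  (b ∷ m′) = ≡.cong (occ b ∷_) (go m m′)
    go (suc _ ∷ m) (b ∷ m′) = ≡.cong (inside ∷_) (go m m′)

  -- The formal coefficient is an iterated product of `1#`, so it is only `≈ 1#`, while the list
  -- itself is literally a singleton.
  Π-var-monomial : ∀ I → ∃₂ λ a m → Π[_] 𝔽 I (var 𝔽) ≡ [ a , m ] × a ≈ 1# × ⟦ m ⟧ ≡ I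
  Π-var-monomial I with go (filter (Subset._∈? I) (allFin N))
    where
    go : ∀ is → ∃₂ λ a m → foldr (λ i s → var 𝔽 i ⊗ᵖ s) (𝟙 𝔽) is ≡ [ a , m ] ×
         a ≈ 1# × ⟦ m ⟧ ≡ foldr (λ i S → ⁅ i ⁆ ∪ S) ⊥ is
    go []       = 1# , _ , ≡.refl , refl , support-1
    go (i ∷ is) with a , m , eq , a≈1 , m≡ ← go is =
      1# * a , _ , ≡.cong (var 𝔽 i ⊗ᵖ_) eq , trans (*-identityˡ a) a≈1 ,
      ≡.trans (support-* _ m) (≡.cong₂ _∪_ (support-var i) m≡)
  ... | a , m , eq , a≈1 , m≡ = a , m , eq , a≈1 , ≡.trans m≡ (foldr-∪≡ I)

  -- With z = linMonomial y this is the value of linearise at Πx I ⊗ p.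
  linAt : (Subset N → Carrier) → Subset N → Poly 𝔽 N → Carrier
  linAt z I = foldr (λ (a , m) s → a * z (I ∪ ⟦ m ⟧) + s) 0#

  module _ (y : Subset N → Carrier) where
    private
      z : Subset N → Carrier
      z = linMonomial 𝔽 y

    -- Multiplying by a single monomial keeps the terms of `p` apart and joins `I` to each support.
    linearise-Π⊗ : ∀ I p → linearise 𝔽 y (Π[_] 𝔽 I (var 𝔽) ⊗ᵖ p) ≈ linAt z I p
    linearise-Π⊗ I p with a , m , eq , a≈1 , m≡ ← Π-var-monomial I =
      trans (reflexive (≡.cong (λ q → linearise 𝔽 y (q ⊗ᵖ p)) eq)) (go p)
      where
      go : ∀ p → linearise 𝔽 y ([ a , m ] ⊗ᵖ p) ≈ linAt z I p
      go []            = refl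
      go ((b , m′) ∷ p) = +-cong
        (*-cong (trans (*-congʳ a≈1) (*-identityˡ b))
                (reflexive (≡.cong z (≡.trans (support-* m m′) (≡.cong (_∪ ⟦ m′ ⟧) m≡)))))
        (go p)

  module _ (z : Subset N → Carrier) (I : Subset N) where

    linAt-++ : ∀ p q → linAt z I (p ++ q) ≈ linAt z I p + linAt z I q
    linAt-++ []      q = sym (+-identityˡ _)
    linAt-++ (_ ∷ p) q = trans (+-congˡ (linAt-++ p q)) (sym (+-assoc _ _ _))

    linAt-neg : ∀ p → linAt z I (map (λ (a , m) → - a , m) p) ≈ - linAt z I p
    linAt-neg []            = sym -0#≈0#
    linAt-neg ((a , m) ∷ p) =
      trans (+-cong (sym (-‿distribˡ-* a _)) (linAt-neg p)) (-‿+-comm _ _)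

    linAt-⊖ : ∀ p q → linAt z I (p ⊖ᵖ q) ≈ linAt z I p - linAt z I q
    linAt-⊖ p q = trans (linAt-++ p _) (+-congˡ (linAt-neg q))

    linAt-monomial : ∀ {a m J} → a ≈ 1# → ⟦ m ⟧ ≡ J → linAt z I [ a , m ] ≈ z (I ∪ J)
    linAt-monomial {a} {m} {J} a≈1 m≡ = begin
      a * z (I ∪ ⟦ m ⟧) + 0# ≈⟨ +-identityʳ _ ⟩
      a * z (I ∪ ⟦ m ⟧)      ≈⟨ *-cong a≈1 (reflexive (≡.cong (λ K → z (I ∪ K)) m≡)) ⟩
      1# * z (I ∪ J)         ≈⟨ *-identityˡ _ ⟩
      z (I ∪ J)              ∎

    linAt-𝟙 : linAt z I (𝟙 𝔽) ≈ z I
    linAt-𝟙 = trans (linAt-monomial refl support-1)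
      (reflexive (≡.cong z (Subset.∪-identityʳ I)))

    linAt-var⊗var : ∀ i j → linAt z I (var 𝔽 i ⊗ᵖ var 𝔽 j) ≈ z (I ∪ (⁅ i ⁆ ∪ ⁅ j ⁆))
    linAt-var⊗var i j = linAt-monomial (*-identityˡ 1#)
      (≡.trans (support-* _ _) (≡.cong₂ _∪_ (support-var i) (support-var j)))

    linAt-Σvar : ∀ {a} {A : Set a} (xs : List A) (i : A → Fin N) →
                 linAt z I (Σvar xs i) ≈ ∑ xs (λ x → z (I ∪ ⁅ i x ⁆))
    linAt-Σvar []       i = refl
    linAt-Σvar (x ∷ xs) i = trans (linAt-++ (var 𝔽 (i x)) (Σvar xs i))
      (+-cong (linAt-monomial refl (support-var (i x))) (linAt-Σvar xs i))

    linAt-Σvar⊖𝟙 : ∀ {a} {A : Set a} (xs : List A) (i : A → Fin N) →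
      linAt z I (Σvar xs i ⊖ᵖ 𝟙 𝔽) ≈ ∑ xs (λ x → z (I ∪ ⁅ i x ⁆)) - z I
    linAt-Σvar⊖𝟙 xs i = trans (linAt-⊖ (Σvar xs i) (𝟙 𝔽)) (+-cong (linAt-Σvar xs i) (-‿cong linAt-𝟙))

    linAt-Σvar⊖Σvar : ∀ {a b} {A : Set a} {B : Set b} (xs : List A) (ys : List B)
      (i : A → Fin N) (j : B → Fin N) →
      linAt z I (Σvar xs i ⊖ᵖ Σvar ys j) ≈
      ∑ xs (λ x → z (I ∪ ⁅ i x ⁆)) - ∑ ys (λ y → z (I ∪ ⁅ j y ⁆))
    linAt-Σvar⊖Σvar xs ys i j =
      trans (linAt-⊖ (Σvar xs i) (Σvar ys j))
            (+-cong (linAt-Σvar xs i) (-‿cong (linAt-Σvar ys j)))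

  -- Bounds the sets at which a linearisation reads `y`; used to see that box constraints survive a
  -- change of `y` on large sets.
  SupportedOn : Subset N → Poly 𝔽 N → Set c
  SupportedOn S = All (λ (a , m) → ⟦ m ⟧ ⊑ S)

  module _ {S : Subset N} where

    supported-𝟙 : SupportedOn S (𝟙 𝔽)
    supported-𝟙 = (λ x∈ → contradiction (≡.subst (_ ∈_) support-1 x∈) Subset.∉⊥) ∷ []

    supported-var : ∀ {i} → i ∈ S → SupportedOn S (var 𝔽 i)
    supported-var {i} i∈S =
      (λ x∈ → ≡.subst (_∈ S) (≡.sym (Subset.x∈⁅y⁆⇒x≡y i (≡.subst (_ ∈_) (support-var i) x∈))) i∈S) ∷ []

    supported-⊖ : ∀ {p q} → SupportedOn S p → SupportedOn S q → SupportedOn S (p ⊖ᵖ q)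
    supported-⊖ p⊑S q⊑S = All.++⁺ p⊑S (All.map⁺ q⊑S)

    supported-⊗ : ∀ {p q} → SupportedOn S p → SupportedOn S q → SupportedOn S (p ⊗ᵖ q)
    supported-⊗ {p} {q} p⊑S q⊑S =
      All.cartesianProductWith⁺ (≡.setoid _) (≡.setoid _) _ p q λ {(_ , m)} {(_ , m′)} s∈p t∈q x∈ →
        [ All.lookup p⊑S s∈p , All.lookup q⊑S t∈q ]′
          (Subset.x∈p∪q⁻ ⟦ m ⟧ ⟦ m′ ⟧ (≡.subst (_ ∈_) (support-* m m′) x∈))

    supported-Π : ∀ {T} {p : Fin N → Poly 𝔽 N} → T ⊑ S →
                  (∀ {i} → i ∈ S → SupportedOn S (p i)) → SupportedOn S (Π[_] 𝔽 T p)
    supported-Π {T} {p} T⊑S p⊑S = go (All.all-filter (Subset._∈? T) (allFin N))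
      where
      go : ∀ {is} → All (_∈ T) is → SupportedOn S (foldr (λ i s → p i ⊗ᵖ s) (𝟙 𝔽) is)
      go []           = supported-𝟙
      go (i∈T ∷ is⊑T) = supported-⊗ (p⊑S (T⊑S i∈T)) (go is⊑T)

    supported-box : ∀ {I} → I ⊑ S →
      SupportedOn S (Π[_] 𝔽 I (var 𝔽) ⊗ᵖ Π[_] 𝔽 (S ─ I) (λ i → 𝟙 𝔽 ⊖ᵖ var 𝔽 i))
    supported-box {I} I⊑S = supported-⊗ (supported-Π I⊑S supported-var)
      (supported-Π (Subset.p─q⊆p S I) (supported-⊖ supported-𝟙 ∘ supported-var))

  linearise-cong : ∀ {y y′ S p} → SupportedOn S p →
    (∀ {I} → I ⊑ S → linMonomial 𝔽 y I ≈ linMonomial 𝔽 y′ I) →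
    linearise 𝔽 y p ≈ linearise 𝔽 y′ p
  linearise-cong []           y≈y′ = refl
  linearise-cong (m⊑S ∷ p⊑S) y≈y′ = +-cong (*-congˡ (y≈y′ m⊑S)) (linearise-cong p⊑S y≈y′)

  Π-∅ : ∀ (I : Subset N) p → Π[_] 𝔽 (I ─ I) p ≡ 𝟙 𝔽
  Π-∅ I p = ≡.cong (foldr (λ i s → p i ⊗ᵖ s) (𝟙 𝔽)) (filter-none (Subset._∈? (I ─ I))
    (All.tabulate {xs = allFin N} λ _ i∈ → Subset.∉⊥ (≡.subst (_ ∈_) (─-self I) i∈)))

  -- Truncation of `y` above size `k`.

  module _ (k : ℕ) (y : Subset N → Carrier) where

    truncate : Subset N → Carrier
    truncate I with ∣ I ∣ ℕ.≤? k
    ... | yes _ = y I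
    ... | no  _ = 0#

    truncate-≤ : ∀ {I} → ∣ I ∣ ℕ.≤ k → truncate I ≈ y I
    truncate-≤ {I} ∣I∣≤k with ∣ I ∣ ℕ.≤? k
    ... | yes _     = refl
    ... | no  ∣I∣≰k = contradiction ∣I∣≤k ∣I∣≰k

    linMonomial-truncate-≤ : ∀ {I} → ∣ I ∣ ℕ.≤ k → linMonomial 𝔽 truncate I ≈ linMonomial 𝔽 y I
    linMonomial-truncate-≤ {I} ∣I∣≤k with Subset.nonempty? I
    ... | yes _ = truncate-≤ ∣I∣≤k
    ... | no  _ = refl

    linMonomial-truncate-> : ∀ {I} → k ℕ.< ∣ I ∣ → linMonomial 𝔽 truncate I ≈ 0#
    linMonomial-truncate-> {I} k<∣I∣ with Subset.nonempty? I
    -- At the empty set `linMonomial` is `1#` for every `y`, but that set has size 0 and so cannot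
    -- exceed `k`.
    ... | no empty = contradiction
      (≡.subst (k ℕ.<_) (≡.trans (≡.cong ∣_∣ (Subset.Empty-unique empty)) (Subset.∣⊥∣≡0 N)) k<∣I∣) λ ()
    ... | yes _ with ∣ I ∣ ℕ.≤? k
    ...   | yes ∣I∣≤k = contradiction ∣I∣≤k (ℕ.<⇒≱ k<∣I∣)
    ...   | no  _     = refl

-- The inclusions between the two hierarchies.

module Inclusions {c ℓ₁ ℓ₂} (𝔽 : OrderedField c ℓ₁ ℓ₂) {n : ℕ} (G H : SimpleGraph n) where

  open OrderedField 𝔽 renaming (_≤_ to _≤ᶠ_)
  open FieldLemmas 𝔽
  open Linearisation 𝔽 {n ℕ.* n}
  open SheraliAdams 𝔽 using (Lifted; Πx; Π1-x)

  private
    module G = SimpleGraph G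
    module H = SimpleGraph H

    T Q : System 𝔽 (n ℕ.* n)
    T = 𝒯-system 𝔽 G H
    Q = 𝒬-system 𝔽 G H

    cell : Cell {n ℕ.* n} {n}
    cell = combine

  -- Take `J = I` in the box constraint: the product of the factors `1 - x` is then empty.
  box⇒nonneg : ∀ (P : System 𝔽 (n ℕ.* n)) {k y} → Lifted P k y →
               ∀ I → ∣ I ∣ ℕ.≤ k → 0# ≤ᶠ linMonomial 𝔽 y I
  box⇒nonneg P {k} {y} lifted I ∣I∣≤k = ≤-respʳ-≈ eq (Lifted.box lifted I I (λ x∈ → x∈) ∣I∣≤k)
    where
    open ≈-Reasoning setoid
    eq : linearise 𝔽 y (Πx P I ⊗ᵖ Π1-x P (I ─ I)) ≈ linMonomial 𝔽 y I
    eq = begin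
      linearise 𝔽 y (Πx P I ⊗ᵖ Π1-x P (I ─ I))
        ≡⟨ ≡.cong (λ q → linearise 𝔽 y (Πx P I ⊗ᵖ q)) (Π-∅ I (λ i → 𝟙 𝔽 ⊖ᵖ var 𝔽 i)) ⟩
      linearise 𝔽 y (Πx P I ⊗ᵖ 𝟙 𝔽)   ≈⟨ linearise-Π⊗ y I (𝟙 𝔽) ⟩
      linAt (linMonomial 𝔽 y) I (𝟙 𝔽) ≈⟨ linAt-𝟙 (linMonomial 𝔽 y) I ⟩
      linMonomial 𝔽 y I               ∎

  module _ (y : Subset (n ℕ.* n) → Carrier) (I : Subset (n ℕ.* n)) where
    private
      z : Subset (n ℕ.* n) → Carrier
      z = linMonomial 𝔽 y

    -- Written with `T`, this serves `Q` as well: `Πx` and the row polynomials of both systems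
    -- unfold to the same terms. The same holds for `col-value`.
    row-value : ∀ u → linearise 𝔽 y (Πx T I ⊗ᵖ 𝒯-f 𝔽 G H (row u)) ≈
                ∑ (allFin n) (λ v → z (I ∪ ⁅ cell u v ⁆)) - z I
    row-value u = trans (linearise-Π⊗ y I (𝒯-f 𝔽 G H (row u))) (linAt-Σvar⊖𝟙 z I (allFin n) (cell u))

    col-value : ∀ v → linearise 𝔽 y (Πx T I ⊗ᵖ 𝒯-f 𝔽 G H (col v)) ≈
                ∑ (allFin n) (λ u → z (I ∪ ⁅ cell u v ⁆)) - z I
    col-value v = trans (linearise-Π⊗ y I (𝒯-f 𝔽 G H (col v)))
      (linAt-Σvar⊖𝟙 z I (allFin n) (flip cell v))

    commute-value : ∀ u v → linearise 𝔽 y (Πx T I ⊗ᵖ 𝒯-f 𝔽 G H (commute u v)) ≈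
      ∑ (H.neighbours v) (λ w → z (I ∪ ⁅ cell u w ⁆)) - ∑ (G.neighbours u) (λ w → z (I ∪ ⁅ cell w v ⁆))
    commute-value u v = trans (linearise-Π⊗ y I (𝒯-f 𝔽 G H (commute u v)))
      (linAt-Σvar⊖Σvar z I (H.neighbours v) (G.neighbours u) (cell u) (flip cell v))

    product-value : ∀ u₁ v₁ u₂ v₂ →
      linearise 𝔽 y (Πx T I ⊗ᵖ (X 𝔽 G H u₁ v₁ ⊗ᵖ X 𝔽 G H u₂ v₂)) ≈
      z (I ∪ (⁅ cell u₁ v₁ ⁆ ∪ ⁅ cell u₂ v₂ ⁆))
    product-value u₁ v₁ u₂ v₂ =
      trans (linearise-Π⊗ y I (X 𝔽 G H u₁ v₁ ⊗ᵖ X 𝔽 G H u₂ v₂))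
            (linAt-var⊗var z I (cell u₁ v₁) (cell u₂ v₂))

  -- The same `y` is the witness. The row, column and box constraints of level `k` occur among those
  -- of level `k + 1`; only commutation has to be derived.
  𝒬⊆𝒯 : ∀ k → 𝒬 𝔽 G H (suc k) ⊆ 𝒯 𝔽 G H k
  𝒬⊆𝒯 k (y , x≈y , lifted) = y , x≈y , record
    { eqs   = λ where
        (row u)       I ∣I∣<k → eqs (row u) I (ℕ.m<n⇒m<1+n ∣I∣<k)
        (col v)       I ∣I∣<k → eqs (col v) I (ℕ.m<n⇒m<1+n ∣I∣<k)
        (commute u v) I ∣I∣<k → trans (commute-value y I u v) (x≈y⇒x-y≈0 (commutes u v I ∣I∣<k))
    ; ineqs = λ ()
    ; box   = λ I J I⊑J ∣J∣≤k → box I J I⊑J (ℕ.m≤n⇒m≤1+n ∣J∣≤k)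
    }
    where
    open Lifted Q lifted

    commutes : Commutes cell G H k (linMonomial 𝔽 y)
    commutes = commutes-from-edges cell G H
      (λ u I lt → x-y≈0⇒x≈y _ _ (trans (sym (row-value y I u)) (eqs (row u) I lt)))
      (λ v I lt → x-y≈0⇒x≈y _ _ (trans (sym (col-value y I v)) (eqs (col v) I lt)))
      (λ e ¬e I lt → trans (sym (product-value y I _ _ _ _)) (eqs (edge-nonedge _ _ _ _ e ¬e) I lt))
      (λ e ¬e I lt → trans (sym (product-value y I _ _ _ _)) (eqs (nonedge-edge _ _ _ _ ¬e e) I lt))

  -- In 𝒬ᵏ the quadratic equations also involve y at sets of size k + 1, which
  -- 𝒯ᵏ leaves free; there y is replaced by 0.
  𝒯⊆𝒬 : ∀ k → 1 ≤ k → 𝒯 𝔽 G H k ⊆ 𝒬 𝔽 G H k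
  𝒯⊆𝒬 k 1≤k (y , x≈y , lifted) = y′ , x≈y′ x≈y , record
    { eqs   = λ where
        (row u) I ∣I∣<k → trans (row-value y′ I u) (x≈y⇒x-y≈0 (rows′ rows u I ∣I∣<k))
        (col v) I ∣I∣<k → trans (col-value y′ I v) (x≈y⇒x-y≈0 (rows′ cols v I ∣I∣<k))
        (edge-nonedge u₁ u₂ v₁ v₂ e ¬e) I _ → trans (product-value y′ I u₁ v₁ u₂ v₂)
          (vanishes I u₁ v₁ u₂ v₂ (edge-nonedge≈0 cell G H combine-injectiveˡ nonneg rows commutes e ¬e))
        (nonedge-edge u₁ u₂ v₁ v₂ ¬e e) I _ → trans (product-value y′ I u₁ v₁ u₂ v₂)
          (vanishes I u₁ v₁ u₂ v₂ (edge-nonedge≈0 (flip cell) H G combine-injectiveʳ nonneg cols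
            -- Flipping the cells exchanges the two sides of the commutation equation.
            (λ v u I lt → sym (commutes u v I lt)) e ¬e))
    ; ineqs = λ ()
    -- This constraint reads `y` only at subsets of `J`, where truncation changes nothing.
    ; box   = λ I J I⊑J ∣J∣≤k → ≤-respʳ-≈
        (linearise-cong (supported-box I⊑J) λ K⊑J →
          sym (linMonomial-truncate-≤ k y (ℕ.≤-trans (Subset.p⊆q⇒∣p∣≤∣q∣ K⊑J) ∣J∣≤k)))
        (box I J I⊑J ∣J∣≤k)
    }
    where
    open Lifted T lifted
    z = linMonomial 𝔽 y
    y′ = truncate k y
    z′ = linMonomial 𝔽 y′

    -- Here `1≤k` enters: singletons survive the truncation, so the projected point stays the same.
    x≈y′ : ∀ {x : Fin (n ℕ.* n) → Carrier} → (∀ i → x i ≈ y ⁅ i ⁆) → ∀ i → x i ≈ y′ ⁅ i ⁆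
    x≈y′ x≈y i = trans (x≈y i)
      (sym (truncate-≤ k y (≡.subst (ℕ._≤ k) (≡.sym (Subset.∣⁅x⁆∣≡1 i)) 1≤k)))

    combine-injectiveˡ : ∀ {u u′ v v′} → cell u v ≡ cell u′ v′ → u ≡ u′
    combine-injectiveˡ = Fin.combine-injectiveˡ _ _ _ _

    combine-injectiveʳ : ∀ {v v′ u u′} → cell u v ≡ cell u′ v′ → v ≡ v′
    combine-injectiveʳ {v} {v′} {u} {u′} = Fin.combine-injectiveʳ u v u′ v′

    nonneg : ∀ I → ∣ I ∣ ℕ.≤ k → 0# ≤ᶠ z I
    nonneg = box⇒nonneg T lifted

    rows : Rows cell k z
    rows u I lt = x-y≈0⇒x≈y _ _ (trans (sym (row-value y I u)) (eqs (row u) I lt))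

    cols : Rows (flip cell) k z
    cols v I lt = x-y≈0⇒x≈y _ _ (trans (sym (col-value y I v)) (eqs (col v) I lt))

    commutes : Commutes cell G H k z
    commutes u v I lt = x-y≈0⇒x≈y _ _ (trans (sym (commute-value y I u v)) (eqs (commute u v) I lt))

    -- Row equations are linear, so for `I` of size below `k` they only involve sets of size at most
    -- `k`.
    rows′ : ∀ {cell : Cell {n ℕ.* n} {n}} → Rows cell k z → Rows cell k z′
    rows′ {cell} rows u I ∣I∣<k = trans
      (trans (∑-cong (allFin n) λ {v} _ →
               linMonomial-truncate-≤ k y (ℕ.≤-trans (∣p∪⁅x⁆∣≤1+∣p∣ I (cell u v)) ∣I∣<k))
             (rows u I ∣I∣<k))
      (sym (linMonomial-truncate-≤ k y (ℕ.<⇒≤ ∣I∣<k)))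

    -- The set in question may reach size `k + 1` when `I` has size `k - 1`. Up to size `k` the
    -- assumption on `z` applies; above it truncation gives zero.
    vanishes : ∀ I u₁ v₁ u₂ v₂ →
      (∀ {J} → cell u₁ v₁ ∈ J → cell u₂ v₂ ∈ J → ∣ J ∣ ℕ.≤ k → z J ≈ 0#) →
      z′ (I ∪ (⁅ cell u₁ v₁ ⁆ ∪ ⁅ cell u₂ v₂ ⁆)) ≈ 0#
    vanishes I u₁ v₁ u₂ v₂ z≈0 =
      [ (λ ≤k → trans (linMonomial-truncate-≤ k y ≤k) (z≈0
          (Subset.x∈p∪q⁺ (inj₂ (Subset.x∈p∪q⁺ (inj₁ (Subset.x∈⁅x⁆ _)))))
          (Subset.x∈p∪q⁺ (inj₂ (Subset.x∈p∪q⁺ (inj₂ (Subset.x∈⁅x⁆ _))))) ≤k))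
      , linMonomial-truncate-> k y
      ]′ (ℕ.≤-<-connex ∣ I ∪ (⁅ cell u₁ v₁ ⁆ ∪ ⁅ cell u₂ v₂ ⁆) ∣ k)

lemma1p3 : ∀ {c ℓ₁ ℓ₂} (𝔽 : OrderedField c ℓ₁ ℓ₂)
    (n : ℕ) (G H : SimpleGraph n) (k : ℕ) → 1 ≤ k →
    ((𝒬 𝔽 G H (suc k) ⊆ 𝒯 𝔽 G H k) × (𝒯 𝔽 G H k ⊆ 𝒬 𝔽 G H k)) ×
    ((𝒬ᵃ 𝔽 G (suc k) ⊆ 𝒯ᵃ 𝔽 G k) × (𝒯ᵃ 𝔽 G k ⊆ 𝒬ᵃ 𝔽 G k))
lemma1p3 𝔽 n G H k 1≤k = inclusions H , inclusions G
  where
  open Inclusions 𝔽 G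

  -- The second graph is left general, so that `H = G` yields the second pair of inclusions.
  inclusions : ∀ H → (𝒬 𝔽 G H (suc k) ⊆ 𝒯 𝔽 G H k) × (𝒯 𝔽 G H k ⊆ 𝒬 𝔽 G H k)
  inclusions H = (λ {M} → 𝒬⊆𝒯 H k {M}) , (λ {M} → 𝒯⊆𝒬 H k 1≤k {M})
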